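{- Let $G$ be a finite group. Then the enhanced power graph $\mathcal{E}(G)$ is claw-free if and only if $G$ is cyclic.
   Context: For a finite group $G$, the enhanced power graph $\mathcal{E}(G)$ is the graph with vertex set $G$ in which two distinct vertices $u,v$ are adjacent if and only if there exists $w\in G$ with $u,v\in\langle w\rangle$, equivalently if and only if $\langle u,v\rangle$ is cyclic. A claw is a graph isomorphic to the complete bipartite graph $K_{1,3}$; a graph is claw-free if it contains no induced subgraph isomorphic to a claw. -}

module Defs where

open import Level using (Level; _⊔_; suc; 0ℓ)
open import Algebra.Bundles using (Group)
open import Data.Empty using (⊥)
open import Data.Fin using (Fin)
open import Data.Integer using (ℤ; +_; -[1+_])
open import Data.Nat using (ℕ)
open import Data.Product using (Σ; ∃-syntax; _×_; _,_; proj₁; proj₂)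
open import Data.Sum using (_⊎_; inj₁; inj₂)
open import Data.Unit using (⊤; tt)
open import Function.Base using (_∘_)
open import Function.Bundles using (Inverse; _⇔_)
open import Relation.Binary.Bundles using (Setoid)
open import Relation.Binary.Core using (Rel)
open import Relation.Binary.Definitions
  using (Symmetric; Irreflexive; _Respects_; _Respects₂_)
open import Relation.Binary.PropositionalEquality using (_≡_; refl)
import Relation.Binary.PropositionalEquality as ≡
import Relation.Binary.Construct.On as On
open import Relation.Nullary using (¬_)
open import Relation.Unary using (Pred)
import Algebra.Definitions.RawMonoid as Multiples

private
  variable
    a ℓ r a′ ℓ′ r′ p : Level

record Graph (a ℓ r : Level) : Set (suc (a ⊔ ℓ ⊔ r)) where
  field
    vertices : Setoid a ℓ

  open Setoid vertices public using (_≈_) renaming (Carrier to Vertex)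

  field
    Adj      : Rel Vertex r
    Adj-resp : Adj Respects₂ _≈_
    Adj-sym  : Symmetric Adj
    Adj-irr  : Irreflexive _≈_ Adj

induced : (Γ : Graph a ℓ r) → Pred (Graph.Vertex Γ) p → Graph (a ⊔ p) ℓ r
induced Γ P = record
  { vertices = On.setoid {B = Σ Vertex P} vertices proj₁
  ; Adj      = λ u v → Adj (proj₁ u) (proj₁ v)
  ; Adj-resp = (λ {x} → proj₁ Adj-resp) , (λ {x} → proj₂ Adj-resp)
  ; Adj-sym  = Adj-sym
  ; Adj-irr  = Adj-irr
  }
  where open Graph Γ

record _≅_ (Γ : Graph a ℓ r) (Δ : Graph a′ ℓ′ r′)
           : Set (a ⊔ ℓ ⊔ r ⊔ a′ ⊔ ℓ′ ⊔ r′) where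
  private
    module Γ = Graph Γ
    module Δ = Graph Δ
  field
    bijection : Inverse Γ.vertices Δ.vertices
  open Inverse bijection public
  field
    Adj⇔ : ∀ u v → Γ.Adj u v ⇔ Δ.Adj (to u) (to v)

-- A vertex set is a predicate respecting the vertex equality.  Level ℓ, that
-- of this equality, already contains every explicitly listed finite vertex
-- set { x | x ≈ x₁ ⊎ … ⊎ x ≈ xₖ }, so no finite induced subgraph is missed.
ContainsInduced : Graph a ℓ r → Graph a′ ℓ′ r′ →
                  Set (a ⊔ suc ℓ ⊔ r ⊔ a′ ⊔ ℓ′ ⊔ r′)
ContainsInduced {ℓ = ℓ} Γ Δ =
  Σ (Pred Vertex ℓ) λ P → P Respects _≈_ × (induced Γ P ≅ Δ)
  where open Graph Γ

completeBipartite : ℕ → ℕ → Graph 0ℓ 0ℓ 0ℓ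
completeBipartite m n = record
  { vertices = ≡.setoid (Fin m ⊎ Fin n)
  ; Adj      = Opposite
  ; Adj-resp = ≡.resp₂ Opposite
  ; Adj-sym  = λ {u} {v} → opposite-sym u v
  ; Adj-irr  = λ { {u} refl → opposite-irr u }
  }
  where
  Opposite : Rel (Fin m ⊎ Fin n) 0ℓ
  Opposite (inj₁ _) (inj₁ _) = ⊥
  Opposite (inj₁ _) (inj₂ _) = ⊤
  Opposite (inj₂ _) (inj₁ _) = ⊤
  Opposite (inj₂ _) (inj₂ _) = ⊥

  opposite-sym : ∀ u v → Opposite u v → Opposite v u
  opposite-sym (inj₁ _) (inj₂ _) _ = tt
  opposite-sym (inj₂ _) (inj₁ _) _ = tt

  opposite-irr : ∀ u → ¬ Opposite u u
  opposite-irr (inj₁ _) ()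
  opposite-irr (inj₂ _) ()

claw : Graph 0ℓ 0ℓ 0ℓ
claw = completeBipartite 1 3

ClawFree : Graph a ℓ r → Set (a ⊔ suc ℓ ⊔ r)
ClawFree Γ = ¬ ContainsInduced Γ claw

Finite : Setoid a ℓ → Set (a ⊔ ℓ)
Finite S = ∃[ n ] Inverse S (≡.setoid (Fin n))

module _ (G : Group a ℓ) where
  open Group G
  open Multiples rawMonoid using () renaming (_×_ to _times_)

  -- n times g is the n-fold product of g, written additively in the library.
  infixr 8 _^_
  _^_ : Carrier → ℤ → Carrier
  g ^ (+ n)    = n times g
  g ^ -[1+ n ] = (ℕ.suc n times g) ⁻¹

  ⟨_⟩ : Carrier → Pred Carrier ℓ
  ⟨ g ⟩ x = ∃[ k ] x ≈ g ^ k

  IsCyclic : Set (a ⊔ ℓ)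
  IsCyclic = ∃[ g ] ∀ x → ⟨ g ⟩ x

  enhancedPowerGraph : Graph a ℓ (a ⊔ ℓ)
  enhancedPowerGraph = record
    { vertices = setoid
    ; Adj      = λ u v → ¬ u ≈ v × ∃[ w ] ⟨ w ⟩ u × ⟨ w ⟩ v
    ; Adj-resp =
        (λ v≈v′ (u≉v , w , u∈ , k , v≈wᵏ) →
          (λ u≈v′ → u≉v (trans u≈v′ (sym v≈v′)))
          , w , u∈ , k , trans (sym v≈v′) v≈wᵏ)
      , (λ u≈u′ (u≉v , w , (k , u≈wᵏ) , v∈) →
          (λ u′≈v → u≉v (trans u≈u′ u′≈v))
          , w , (k , trans (sym u≈u′) u≈wᵏ) , v∈)
    ; Adj-sym  = λ (u≉v , w , u∈ , v∈) → u≉v ∘ sym , w , v∈ , u∈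
    ; Adj-irr  = λ u≈v (u≉v , _) → u≉v u≈v
    }

{-# OPTIONS --safe #-}

-- Every element of a finite group lies in a maximal cyclic subgroup, and
-- generators of distinct maximal cyclic subgroups are nonadjacent.  If G is not
-- cyclic, take a maximal ⟨ a ⟩, then a maximal ⟨ b ⟩ ⊈ ⟨ a ⟩.  Neither subgroup
-- contains a ∙ b, so a maximal ⟨ c ⟩ containing a ∙ b differs from both, and
-- ε, a, b, c induce a claw.
module Submission where

open import Defs
open import Level using (0ℓ; _⊔_)
open import Algebra.Bundles using (Group)
import Algebra.Properties.Group as GroupProperties
import Algebra.Properties.Monoid.Mult as Mult
open import Data.Fin using (Fin; zero; suc; toℕ; fromℕ<)
open import Data.Fin.Patterns using (0F; 1F; 2F)
open import Data.Fin.Properties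
  using (all?; any?; inj⇒≟; pigeonhole; toℕ-fromℕ<; ¬∀⟶∃¬)
open import Data.Integer using (+_; -[1+_])
import Data.Nat as ℕ
open import Data.Nat.DivMod using (_%_; _/_; m≡m%n+[m/n]*n; m%n<n)
import Data.Nat.Properties as ℕ
open import Data.Product using (∃-syntax; _×_; _,_; proj₁; proj₂)
open import Data.Sum using (_⊎_; inj₁; inj₂; [_,_])
open import Function.Base using (_∘_; const)
open import Function.Bundles using (Inverse; _⇔_; mk⇔; module Equivalence; module Injection)
open import Function.Properties.Inverse using (Inverse⇒Injection)
open import Relation.Binary.Bundles using (Setoid)
open import Relation.Binary.Core using (Rel)
open import Relation.Binary.Definitions using (Decidable; Reflexive; Transitive)
open import Relation.Binary.PropositionalEquality using (_≡_)
import Relation.Binary.PropositionalEquality as ≡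
import Relation.Binary.Reasoning.Setoid as SetoidReasoning
open import Relation.Nullary using (¬_; yes; no; contradiction)
open import Relation.Nullary.Decidable using (map′)

-- Induced subgraphs and claws from embeddings

embedding⇒containsInduced :
  ∀ {a ℓ r ℓ′ r′} (Γ : Graph a ℓ r) (Δ : Graph 0ℓ ℓ′ r′) →
  let module Γ = Graph Γ; module Δ = Graph Δ in
  (f : Δ.Vertex → Γ.Vertex) →
  (∀ {i j} → i Δ.≈ j → f i Γ.≈ f j) →
  (∀ {i j} → f i Γ.≈ f j → i Δ.≈ j) →
  (∀ i j → Γ.Adj (f i) (f j) ⇔ Δ.Adj i j) →
  ContainsInduced Γ Δ
embedding⇒containsInduced Γ Δ f f-cong f-injective f-adj =
  -- The vertex set is the image of `f`. A membership proof names an index, so the map back reads it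
  -- off; one vertex may have several such proofs, and injectivity of `f` makes the result
  -- independent of the choice.
  (λ v → ∃[ i ] v ≈ f i) ,
  (λ { u≈v (i , u≈fi) → i , trans (sym u≈v) u≈fi }) ,
  record
    { bijection = record
      { to        = λ (_ , i , _) → i
      ; from      = λ i → f i , i , refl
      ; to-cong   = λ { {_ , _ , u≈fi} {_ , _ , v≈fj} u≈v →
                        f-injective (trans (sym u≈fi) (trans u≈v v≈fj)) }
      ; from-cong = f-cong
      ; inverse   = (λ { {_} {_ , _ , v≈fj} v≈fi →
                         f-injective (trans (sym v≈fj) v≈fi) })
                  , (λ { {_ , _ , v≈fj} i≈j →
                         trans (f-cong i≈j) (sym v≈fj) })
      }
    ; Adj⇔ = λ { (_ , i , u≈fi) (_ , j , v≈fj) → mk⇔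
        (λ uv → Equivalence.to (f-adj i j)
          (proj₂ Adj-resp u≈fi (proj₁ Adj-resp v≈fj uv)))
        (λ ij → proj₂ Adj-resp (sym u≈fi)
          (proj₁ Adj-resp (sym v≈fj) (Equivalence.from (f-adj i j) ij))) }
    }
  where
  open Graph Γ
  open Setoid vertices using (refl; sym; trans)

star⇒containsClaw :
  ∀ {a ℓ r} (Γ : Graph a ℓ r) → let open Graph Γ in
  (centre : Vertex) (leaf : Fin 3 → Vertex) →
  (∀ i → Adj centre (leaf i)) →
  (∀ i j → ¬ Adj (leaf i) (leaf j)) →
  (∀ i j → leaf i ≈ leaf j → i ≡ j) →
  ContainsInduced Γ claw
star⇒containsClaw Γ centre leaf spoke independent leaf-injective =
  embedding⇒containsInduced Γ claw vertex
    (λ { ≡.refl → refl }) (vertex-injective _ _) vertex-adj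
  where
  open Graph Γ
  open Setoid vertices using (refl; sym)

  vertex : Fin 1 ⊎ Fin 3 → Vertex
  vertex = [ const centre , leaf ]

  vertex-injective : ∀ i j → vertex i ≈ vertex j → i ≡ j
  vertex-injective (inj₁ 0F) (inj₁ 0F) _  = ≡.refl
  -- Irreflexivity of adjacency keeps the centre apart from the leaves.
  vertex-injective (inj₁ _)  (inj₂ j)  eq = contradiction (spoke j) (Adj-irr eq)
  vertex-injective (inj₂ i)  (inj₁ _)  eq = contradiction (spoke i) (Adj-irr (sym eq))
  vertex-injective (inj₂ i)  (inj₂ j)  eq = ≡.cong inj₂ (leaf-injective i j eq)

  vertex-adj : ∀ i j → Adj (vertex i) (vertex j) ⇔ Graph.Adj claw i j
  vertex-adj (inj₁ _) (inj₁ _) = mk⇔ (Adj-irr refl) (λ ())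
  vertex-adj (inj₁ _) (inj₂ j) = mk⇔ _ (const (spoke j))
  vertex-adj (inj₂ i) (inj₁ _) = mk⇔ _ (const (Adj-sym (spoke i)))
  vertex-adj (inj₂ i) (inj₂ j) = mk⇔ (independent i j) (λ ())

-- Maximal elements of finite preorders

-- Induction on `n`: a maximal `y` for the tail gives way to `f zero` when that lies above it.
-- Whatever is above `f zero` is then above `y`, hence below `y` and so below `f zero`. Maximality
-- is up to mutual `≤`, since one cyclic subgroup can have several generators.
maximalAbove :
  ∀ {a r} {A : Set a} {_≤_ : Rel A r} →
  Reflexive _≤_ → Transitive _≤_ → Decidable _≤_ →
  ∀ {n} (f : Fin n → A) x →
  ∃[ y ] x ≤ y × (∀ i → y ≤ f i → f i ≤ y)
maximalAbove rfl trn _≤?_ {ℕ.zero}  f x = x , rfl , λ ()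
maximalAbove rfl trn _≤?_ {ℕ.suc n} f x
  with y , x≤y , y-max ← maximalAbove rfl trn _≤?_ (f ∘ suc) x
  with y ≤? f zero
... | yes y≤z = f zero , trn x≤y y≤z ,
      λ { zero    _    → rfl
        ; (suc i) z≤fi → trn (y-max i (trn y≤z z≤fi)) y≤z }
... | no  y≰z = y , x≤y ,
      λ { zero    y≤z → contradiction y≤z y≰z
        ; (suc i) y≤fi → y-max i y≤fi }

-- Cyclic groups

-- The generator `g` makes any two distinct elements adjacent, whereas two leaves of a claw are not.
cyclic⇒clawFree : ∀ {c ℓ} (G : Group c ℓ) →
                  IsCyclic G → ClawFree (enhancedPowerGraph G)
cyclic⇒clawFree G (g , generates) (P , _ , iso) =
  -- Adjacency of the leaves `i` and `j` computes to `⊥`, which is the goal.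
  ≡.subst₂ (Graph.Adj claw) to-u≡i to-v≡j (Equivalence.to (Adj⇔ u v) adj)
  where
  open _≅_ iso
  i j : Graph.Vertex claw
  i = inj₂ 0F
  j = inj₂ 1F
  u = from i
  v = from j

  to-u≡i : to u ≡ i
  to-u≡i = inverseˡ (Group.refl G)

  to-v≡j : to v ≡ j
  to-v≡j = inverseˡ (Group.refl G)

  u≉v : ¬ Group._≈_ G (proj₁ u) (proj₁ v)
  u≉v u≈v with () ← ≡.trans (≡.sym to-u≡i) (≡.trans (to-cong {u} {v} u≈v) to-v≡j)

  adj : Graph.Adj (enhancedPowerGraph G) (proj₁ u) (proj₁ v)
  adj = u≉v , g , generates _ , generates _

-- Cyclic subgroups of a finite group

module FiniteGroup {c ℓ} (G : Group c ℓ) (finite : Finite (Group.setoid G)) where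
  open Group G
  open GroupProperties G 
    using (identityʳ-unique; inverseʳ-unique; \\-leftDividesʳ; //-rightDividesʳ)
  open Mult monoid using (×-congʳ; ×-congˡ; ×-homo-+; ×-assocˡ)
    renaming (_×_ to _times_)
  open SetoidReasoning setoid

  private
    size = proj₁ finite
    module Enum = Inverse (proj₂ finite)
    injection = Inverse⇒Injection (proj₂ finite)

  infix 4 _≈?_
  _≈?_ : Decidable _≈_
  _≈?_ = inj⇒≟ injection

  -- Two of the powers of `w` with exponents from 0 to `size` agree by pigeonhole, and cancelling
  -- the smaller one leaves a positive exponent. Returning its predecessor makes the exponent
  -- visibly nonzero, as division by it requires.
  exponent : ∀ w → ∃[ d ] ℕ.suc d times w ≈ ε
  exponent w
    with i , j , i<j , eq ← pigeonhole (ℕ.n<1+n size) (λ i → Enum.to (toℕ i times w))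
    with o , 1+i+o≡j ← ℕ.m≤n⇒∃[o]m+o≡n i<j
    = o , identityʳ-unique (toℕ i times w) (ℕ.suc o times w) (begin
      toℕ i times w ∙ ℕ.suc o times w ≈⟨ ×-homo-+ w (toℕ i) (ℕ.suc o) ⟨
      (toℕ i ℕ.+ ℕ.suc o) times w     ≈⟨ ×-congˡ (≡.trans (ℕ.+-suc (toℕ i) o) 1+i+o≡j) ⟩
      toℕ j times w                   ≈⟨ Injection.injective injection eq ⟨
      toℕ i times w                   ∎)

  times-ε : ∀ n → n times ε ≈ ε
  times-ε ℕ.zero    = refl
  times-ε (ℕ.suc n) = trans (identityˡ _) (times-ε n)

  multiple≈ε : ∀ {d w} → d times w ≈ ε → ∀ n → (n ℕ.* d) times w ≈ ε
  multiple≈ε {d} {w} dw≈ε n =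
    trans (sym (×-assocˡ w n d)) (trans (×-congʳ n dw≈ε) (times-ε n))

  infix 4 _∈⟨_⟩ _∈⟨_⟩?

  -- Natural exponents suffice because w has finite order.
  _∈⟨_⟩ : Rel Carrier ℓ
  x ∈⟨ w ⟩ = ∃[ n ] x ≈ n times w

  -- The exponent `n * d` inverts the exponent `n`, because their sum is `n * suc d` and `suc d`
  -- times `w` is trivial.
  inverse-∈⟨⟩ : ∀ {x w} → x ∈⟨ w ⟩ → x ⁻¹ ∈⟨ w ⟩
  inverse-∈⟨⟩ {x} {w} (n , x≈nw) with d , dw≈ε ← exponent w =
    n ℕ.* d , sym (inverseʳ-unique x _ (begin
      x ∙ (n ℕ.* d) times w           ≈⟨ ∙-congʳ x≈nw ⟩
      n times w ∙ (n ℕ.* d) times w   ≈⟨ ×-homo-+ w n (n ℕ.* d) ⟨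
      (n ℕ.+ n ℕ.* d) times w         ≈⟨ ×-congˡ (ℕ.*-suc n d) ⟨
      (n ℕ.* ℕ.suc d) times w         ≈⟨ multiple≈ε dw≈ε n ⟩
      ε                               ∎))

  ∙-∈⟨⟩ : ∀ {x y w} → x ∈⟨ w ⟩ → y ∈⟨ w ⟩ → x ∙ y ∈⟨ w ⟩
  ∙-∈⟨⟩ {w = w} (m , x≈mw) (n , y≈nw) =
    m ℕ.+ n , trans (∙-cong x≈mw y≈nw) (sym (×-homo-+ w m n))

  ∈⟨⟩-resp-≈ : ∀ {x y w} → x ≈ y → x ∈⟨ w ⟩ → y ∈⟨ w ⟩
  ∈⟨⟩-resp-≈ x≈y (n , x≈nw) = n , trans (sym x≈y) x≈nw

  -- Multiply by the inverse of the known factor. With its mirror image, this later keeps `a ∙ b`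
  -- out of both `⟨ a ⟩` and `⟨ b ⟩`.
  ∙-∈⟨⟩-cancelˡ : ∀ {x y w} → x ∈⟨ w ⟩ → x ∙ y ∈⟨ w ⟩ → y ∈⟨ w ⟩
  ∙-∈⟨⟩-cancelˡ {x} {y} x∈ xy∈ =
    ∈⟨⟩-resp-≈ (\\-leftDividesʳ x y) (∙-∈⟨⟩ (inverse-∈⟨⟩ x∈) xy∈)

  ∙-∈⟨⟩-cancelʳ : ∀ {x y w} → y ∈⟨ w ⟩ → x ∙ y ∈⟨ w ⟩ → x ∈⟨ w ⟩
  ∙-∈⟨⟩-cancelʳ {x} {y} y∈ xy∈ =
    ∈⟨⟩-resp-≈ (//-rightDividesʳ y x) (∙-∈⟨⟩ xy∈ (inverse-∈⟨⟩ y∈))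

  ∈⟨⟩-refl : Reflexive _∈⟨_⟩
  ∈⟨⟩-refl {x} = 1 , sym (identityʳ x)

  ∈⟨⟩-trans : Transitive _∈⟨_⟩
  ∈⟨⟩-trans {k = w} (m , x≈my) (n , y≈nw) =
    m ℕ.* n , trans x≈my (trans (×-congʳ m y≈nw) (×-assocˡ w m n))

  ⟨⟩⇒∈⟨⟩ : ∀ {x w} → ⟨_⟩ G w x → x ∈⟨ w ⟩
  ⟨⟩⇒∈⟨⟩ (+ n      , x≈) = n , x≈
  ⟨⟩⇒∈⟨⟩ (-[1+ n ] , x≈) = ∈⟨⟩-resp-≈ (sym x≈) (inverse-∈⟨⟩ (ℕ.suc n , refl))

  ∈⟨⟩⇒⟨⟩ : ∀ {x w} → x ∈⟨ w ⟩ → ⟨_⟩ G w x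
  ∈⟨⟩⇒⟨⟩ (n , x≈nw) = + n , x≈nw

  reduce-exponent : ∀ {d w} → ℕ.suc d times w ≈ ε →
                    ∀ n → n times w ≈ (n % ℕ.suc d) times w
  reduce-exponent {d} {w} dw≈ε n = begin
    n times w                                     ≈⟨ ×-congˡ (m≡m%n+[m/n]*n n (ℕ.suc d)) ⟩
    (r ℕ.+ q ℕ.* ℕ.suc d) times w                 ≈⟨ ×-homo-+ w r (q ℕ.* ℕ.suc d) ⟩
    r times w ∙ (q ℕ.* ℕ.suc d) times w           ≈⟨ ∙-congˡ (multiple≈ε dw≈ε q) ⟩
    r times w ∙ ε                                 ≈⟨ identityʳ _ ⟩
    r times w                                     ∎
    where
    r = n % ℕ.suc d
    q = n / ℕ.suc d

  -- The search for an exponent becomes finite, since the remainders modulo `suc d` already give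
  -- every power of `w`.
  _∈⟨_⟩? : Decidable _∈⟨_⟩
  x ∈⟨ w ⟩? with d , dw≈ε ← exponent w =
    map′ (λ (i , x≈iw) → toℕ i , x≈iw)
         (λ (n , x≈nw) → fromℕ< (m%n<n n (ℕ.suc d)) , (begin
           x                                            ≈⟨ x≈nw ⟩
           n times w                                    ≈⟨ reduce-exponent dw≈ε n ⟩
           (n % ℕ.suc d) times w                        ≈⟨ ×-congˡ {w} (toℕ-fromℕ< (m%n<n n (ℕ.suc d))) ⟨
           toℕ (fromℕ< (m%n<n n (ℕ.suc d))) times w     ∎))
         (any? λ i → x ≈? toℕ i times w)

  -- Maximal cyclic subgroups and claws

  -- Membership `x ∈⟨ w ⟩` amounts to inclusion of `⟨ x ⟩` in `⟨ w ⟩`, so this is maximality of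
  -- `⟨ m ⟩` among cyclic subgroups.
  Maximal : Carrier → Set (c ⊔ ℓ)
  Maximal m = ∀ w → m ∈⟨ w ⟩ → w ∈⟨ m ⟩

  enumerated : ∀ x → Enum.from (Enum.to x) ≈ x
  enumerated x = Enum.inverseʳ ≡.refl

  ∈⟨⟩-maximal : ∀ x → ∃[ m ] x ∈⟨ m ⟩ × Maximal m
  ∈⟨⟩-maximal x
    with m , x∈m , m-max ← maximalAbove ∈⟨⟩-refl ∈⟨⟩-trans _∈⟨_⟩? Enum.from x
    -- `m-max` speaks only of enumerated elements, so `w` is replaced by its enumerated copy and
    -- back.
    = m , x∈m , λ w m∈w → ∈⟨⟩-resp-≈ (enumerated w)
        (m-max (Enum.to w) (∈⟨⟩-trans m∈w (1 , trans (sym (enumerated w)) (sym (identityʳ _)))))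

  generates? : ∀ g → (∀ x → x ∈⟨ g ⟩) ⊎ (∃[ x ] ¬ x ∈⟨ g ⟩)
  generates? g with all? (λ i → Enum.from i ∈⟨ g ⟩?)
  ... | yes all = inj₁ λ x → ∈⟨⟩-resp-≈ (enumerated x) (all (Enum.to x))
  ... | no ¬all with i , i∉ ← ¬∀⟶∃¬ size _ (λ i → Enum.from i ∈⟨ g ⟩?) ¬all
    = inj₂ (Enum.from i , i∉)

  -- Unlike nonadjacency, this also forces distinctness, since every element lies in the subgroup it
  -- generates.
  Separate : Rel Carrier (c ⊔ ℓ)
  Separate x y = ∀ w → x ∈⟨ w ⟩ → ¬ y ∈⟨ w ⟩

  -- If `⟨ w ⟩` contained both, maximality would give `w ∈⟨ m ⟩`, hence `⟨ m′ ⟩` and with it `x`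
  -- would lie in `⟨ m ⟩`.
  maximal-separate : ∀ {m m′ x} → Maximal m → ¬ x ∈⟨ m ⟩ → x ∈⟨ m′ ⟩ → Separate m m′
  maximal-separate m-max x∉m x∈m′ w m∈w m′∈w =
    x∉m (∈⟨⟩-trans x∈m′ (∈⟨⟩-trans m′∈w (m-max w m∈w)))

  -- The centre is `ε`, which lies in every cyclic subgroup.
  separate⇒claw : ∀ {x y z} → Separate x y → Separate x z → Separate y z →
                  ContainsInduced (enhancedPowerGraph G) claw
  separate⇒claw {x} {y} {z} xy xz yz =
    star⇒containsClaw (enhancedPowerGraph G) ε leaf spoke independent leaf-injective
    where
    leaf : Fin 3 → Carrier
    leaf 0F = x
    leaf 1F = y
    leaf 2F = z

    swap : ∀ {u v} → Separate u v → Separate v u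
    swap uv w v∈ u∈ = uv w u∈ v∈

    separate : ∀ i j → i ≡ j ⊎ Separate (leaf i) (leaf j)
    separate 0F 0F = inj₁ ≡.refl
    separate 0F 1F = inj₂ xy
    separate 0F 2F = inj₂ xz
    separate 1F 0F = inj₂ (swap xy)
    separate 1F 1F = inj₁ ≡.refl
    separate 1F 2F = inj₂ yz
    separate 2F 0F = inj₂ (swap xz)
    separate 2F 1F = inj₂ (swap yz)
    separate 2F 2F = inj₁ ≡.refl

    independent : ∀ i j → ¬ Graph.Adj (enhancedPowerGraph G) (leaf i) (leaf j)
    independent i j (i≉j , w , i∈ , j∈) with separate i j
    ... | inj₁ ≡.refl = i≉j refl
    ... | inj₂ sep    = sep w (⟨⟩⇒∈⟨⟩ i∈) (⟨⟩⇒∈⟨⟩ j∈)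

    leaf-injective : ∀ i j → leaf i ≈ leaf j → i ≡ j
    leaf-injective i j eq with separate i j
    ... | inj₁ i≡j = i≡j
    ... | inj₂ sep = contradiction ∈⟨⟩-refl (sep _ (∈⟨⟩-resp-≈ (sym eq) ∈⟨⟩-refl))

    -- If `u` were `ε`, then `⟨ v ⟩` would contain both `u` and `v`.
    ε≉separate : ∀ {u v} → Separate u v → ¬ ε ≈ u
    ε≉separate uv ε≈u = uv _ (0 , sym ε≈u) ∈⟨⟩-refl

    ε≉leaf : ∀ i → ¬ ε ≈ leaf i
    ε≉leaf 0F = ε≉separate xy
    ε≉leaf 1F = ε≉separate yz
    ε≉leaf 2F = ε≉separate (swap xz)

    spoke : ∀ i → Graph.Adj (enhancedPowerGraph G) ε (leaf i)
    spoke i = ε≉leaf i , leaf i , (+ 0 , refl) , ∈⟨⟩⇒⟨⟩ ∈⟨⟩-refl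

  clawFree⇒cyclic : ClawFree (enhancedPowerGraph G) → IsCyclic G
  clawFree⇒cyclic clawFree
    -- Any maximal cyclic subgroup will do; `ε` only starts the search.
    with a , _ , a-max ← ∈⟨⟩-maximal ε
    with generates? a
  ... | inj₁ a-generates = a , λ x → ∈⟨⟩⇒⟨⟩ (a-generates x)
  ... | inj₂ (x , x∉a)
    with b , x∈b , b-max ← ∈⟨⟩-maximal x
    with c , ab∈c , _ ← ∈⟨⟩-maximal (a ∙ b)
    = contradiction
        (separate⇒claw a∣b
          -- Here `a ∙ b` witnesses that `⟨ c ⟩` is not inside `⟨ a ⟩`: otherwise cancelling `a`
          -- would put `b` in `⟨ a ⟩`, against `a∣b`. The case of `⟨ b ⟩` is symmetric.
          (maximal-separate a-max (a∣b a ∈⟨⟩-refl ∘ ∙-∈⟨⟩-cancelˡ ∈⟨⟩-refl) ab∈c)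
          (maximal-separate b-max
            (λ ab∈b → a∣b b (∙-∈⟨⟩-cancelʳ ∈⟨⟩-refl ab∈b) ∈⟨⟩-refl) ab∈c))
        clawFree
    where
    a∣b : Separate a b
    a∣b = maximal-separate a-max x∉a x∈b

theorem2p1 : ∀ {c ℓ} (G : Group c ℓ) → Finite (Group.setoid G) →
    ClawFree (enhancedPowerGraph G) ⇔ IsCyclic G
theorem2p1 G finite =
  mk⇔ (FiniteGroup.clawFree⇒cyclic G finite) (cyclic⇒clawFree G)
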